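{- For every integer $n\ge 0$, there is a bijection between the set of permutations in $\mathcal{S}_{n+1}$ that avoid the partially ordered generalized pattern $3$-$12$-$3$ and the set of bicolored set partitions of $[n]$.
   Context: $[n]=\{1,\dots,n\}$; $\mathcal{S}_n$ is the set of permutations of $[n]$, written as words $a_1a_2\dots a_n$. A partially ordered generalized pattern is a word $p_1p_2\dots p_m$ of positive integers (repetitions allowed) with a dash written between some of the consecutive letters. An occurrence of it in a permutation $\pi=a_1\dots a_n$ is a subsequence $a_{k_1}a_{k_2}\dots a_{k_m}$ with $k_1<k_2<\dots<k_m$ such that (a) $p_i>p_j$ implies $a_{k_i}>a_{k_j}$ for all $i,j$ (no condition is imposed when $p_i=p_j$), and (b) $k_{i+1}=k_i+1$ whenever $p_i$ and $p_{i+1}$ are not separated by a dash. $\pi$ avoids the pattern if it has no occurrence of it. Thus an occurrence of $3$-$12$-$3$ consists of four elements $c,a,b,d$ appearing in this order, with $a,b$ adjacent, $a<b$, and $b<c$, $b<d$. A bicolored set partition of a set $S$ is a partition of $S$ into nonempty disjoint blocks together with an assignment of one of two fixed colors to each block. -}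

module Defs where

open import Level using (0ℓ)
open import Data.Bool using (Bool; true; false)
open import Data.Fin using (Fin; toℕ; inject₁; suc; _<_)
open import Data.Fin.Permutation using (Permutation′; _⟨$⟩ʳ_)
open import Data.Fin.Subset using (Subset; Nonempty; Empty; _∩_; ⋃; ⊤)
open import Data.List using (List; map)
open import Data.List.Relation.Binary.BagAndSetEquality using ([_]-Equality; set)
open import Data.List.Relation.Unary.All using (All)
open import Data.List.Relation.Unary.AllPairs using (AllPairs)
open import Data.Nat as ℕ using (ℕ; NonZero)
open import Data.Product using (Σ; _×_; proj₁)
open import Data.Vec using (Vec; []; _∷_; lookup)
import Data.Vec.Relation.Unary.All as Vec
open import Function using (_∘_)
open import Relation.Binary using (Setoid)
open import Relation.Binary.PropositionalEquality using (_≡_; _→-setoid_)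
import Relation.Binary.Construct.On as On
open import Relation.Nullary using (¬_)

-- [n] is represented by Fin n, and the permutation word a₁ a₂ … aₙ by
-- the values π ⟨$⟩ʳ 0, π ⟨$⟩ʳ 1, ….

-- dashed records, for each i, whether a dash is written between the
-- letters at positions i and i + 1.
record Pattern : Set where
  field
    {gaps}   : ℕ
    letters  : Vec ℕ (ℕ.suc gaps)
    positive : Vec.All NonZero letters
    dashed   : Vec Bool gaps

record Occurrence (p : Pattern) {n : ℕ} (π : Permutation′ n) : Set where
  open Pattern p
  field
    position   : Fin (ℕ.suc gaps) → Fin n
    increasing : ∀ i j → i < j → position i < position j
    ordered    : ∀ i j → lookup letters i ℕ.> lookup letters j →
                 π ⟨$⟩ʳ position j < π ⟨$⟩ʳ position i
    adjacent   : ∀ i → lookup dashed i ≡ false →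
                 toℕ (position (suc i)) ≡ ℕ.suc (toℕ (position (inject₁ i)))

Avoids : Pattern → {n : ℕ} → Permutation′ n → Set
Avoids p π = ¬ Occurrence p π

-- Permutations are compared as words: the avoidance proof and the
-- inverse carried by Permutation′ are ignored.
Avoiders : Pattern → ℕ → Setoid 0ℓ 0ℓ
Avoiders p n =
  On.setoid {B = Σ (Permutation′ n) (Avoids p)} (Fin n →-setoid Fin n)
            (_⟨$⟩ʳ_ ∘ proj₁)

3-12-3 : Pattern
3-12-3 = record
  { letters  = 3 ∷ 1 ∷ 2 ∷ 3 ∷ []
  ; positive = _ Vec.∷ _ Vec.∷ _ Vec.∷ _ Vec.∷ Vec.[]
  ; dashed   = true ∷ false ∷ true ∷ []
  }

record IsSetPartition {n : ℕ} (blocks : List (Subset n)) : Set where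
  field
    nonempty : All Nonempty blocks
    disjoint : AllPairs (λ B C → Empty (B ∩ C)) blocks
    covering : ⋃ blocks ≡ ⊤

Colour : Set
Colour = Fin 2

record BicolouredPartition (n : ℕ) : Set where
  field
    colouredBlocks : List (Subset n × Colour)
    isSetPartition : IsSetPartition (map proj₁ colouredBlocks)

-- Two coloured partitions are equal when they have the same set of
-- coloured blocks; the order in which the blocks are listed is ignored.
BicolouredPartitions : ℕ → Setoid 0ℓ 0ℓ
BicolouredPartitions n =
  On.setoid {B = BicolouredPartition n} ([ set ]-Equality (Subset n × Colour))
            BicolouredPartition.colouredBlocks

{-# OPTIONS --safe #-}

-- Let M be the largest value of an avoider and attach to every value i a
-- colour, left or right, according to the side of M it stands on, and a head:
-- the largest value between i and the beginning of the word (i on the left) or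
-- between i and its end (i on the right).  The fibres of the head map are the
-- blocks of a bicoloured partition, once {M} is dropped.  Since M can play one
-- of the two 3s, avoidance says exactly that every ascent top on the left is a
-- left-to-right maximum and every ascent top on the right is a right-to-left
-- maximum (M itself being both).  Hence the left blocks appear by increasing
-- maximum, each written decreasingly, and the right blocks by decreasing
-- maximum, each written decreasingly except that its maximum comes last.  So the
-- word is recovered by sorting the values by colour and head, and every
-- bicoloured partition arises in this way.
module Submission where

open import Defs
open import Data.Bool using (false)
open import Data.Empty using (⊥; ⊥-elim)
open import Data.Fin
  using (Fin; zero; suc; toℕ; fromℕ; fromℕ<; inject₁; punchOut; _≤_; _<_)
open import Data.Fin.Induction using (<-weakInduction)
open import Data.Fin.Patterns using (0F; 1F; 2F; 3F)
open import Data.Fin.Permutation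
  using (Permutation′; permutation; _⟨$⟩ʳ_; _⟨$⟩ˡ_; inverseˡ; inverseʳ)
open import Data.Fin.Properties
  using ( _≟_; _≤?_; _<?_; any?; <-cmp; ≤-antisym; ≤-refl; ≤-reflexive; ≤-trans
        ; <-trans; <-irrefl; <⇒≢; ≤∧≢⇒<; ≤fromℕ; fromℕ≢inject₁; inject₁-injective
        ; toℕ-inject₁; toℕ-fromℕ<; punchOut-injective; injective⇒≤)
open import Data.Fin.Relation.Unary.Top
  using (view; ‵fromℕ; ‵inject₁; view-fromℕ; view-inject₁)
open import Data.Fin.Subset using (Subset; Empty; _∈_; _∩_; ∣_∣; ⋃)
open import Data.Fin.Subset.Properties
  using ( _∈?_; ∈⊤; ⊆⊤; ⊆-antisym; ∉⊥; ∣⊤∣≡n; p⊂q⇒∣p∣<∣q∣; x∈p∩q⁺; x∈p∩q⁻; x∈p∪q⁺; x∈p∪q⁻)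
open import Data.List using (List; []; _∷_; map; filter; allFin)
open import Data.List.Membership.Propositional renaming (_∈_ to _∈ᴸ_)
open import Data.List.Membership.Propositional.Properties
  using (∈-map⁺; ∈-map⁻; ∈-allFin; ∈-map∘filter⁺; ∈-map∘filter⁻)
open import Data.List.Relation.Unary.All using (All)
import Data.List.Relation.Unary.All as All
open import Data.List.Relation.Unary.All.Properties using (all-filter)
import Data.List.Relation.Unary.All.Properties as All
open import Data.List.Relation.Unary.AllPairs using (AllPairs; _∷_)
import Data.List.Relation.Unary.AllPairs as AllPairs
import Data.List.Relation.Unary.AllPairs.Properties as AllPairs
open import Data.List.Relation.Unary.Any using (here; there)
open import Data.Nat as ℕ using (ℕ; suc; z≤n; s≤s)
import Data.Nat.Properties as ℕ
open import Data.Product using (Σ; ∃; ∃₂; _×_; _,_; proj₁; proj₂)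
open import Data.Sum using (_⊎_; inj₁; inj₂; [_,_]′)
open import Data.Unit using (tt) renaming (⊤ to Unit)
open import Data.Vec as Vec using (tabulate)
open import Data.Vec.Properties using (tabulate-cong; lookup∘tabulate; []=⇒lookup; lookup⇒[]=)
open import Function using (_∘_; id; mk⇔)
open import Function.Bundles using (Bijection; Equivalence)
open import Function.Construct.Composition using (bijection)
open import Function.Definitions using (Injective)
open import Level using (0ℓ)
open import Relation.Binary using (Setoid; Rel; Transitive; tri<; tri≈; tri>)
import Relation.Binary.Construct.On as On
open import Relation.Binary.PropositionalEquality
  using (_≡_; _≢_; _≗_; refl; sym; trans; cong; cong₂; subst; subst₂; _→-setoid_)
open import Relation.Nullary using (¬_; Dec; yes; no; does; contradiction)
open import Relation.Nullary.Decidable using (dec-true)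
open import Relation.Unary using (Pred; Decidable)

private
  variable
    n N : ℕ

pattern left  = zero
pattern right = suc zero

left-or-right : (c : Colour) → c ≡ left ⊎ c ≡ right
left-or-right left  = inj₁ refl
left-or-right right = inj₂ refl

-- Maxima of decidable predicates

IsMaximum : Pred (Fin N) 0ℓ → Pred (Fin N) 0ℓ
IsMaximum P m = P m × (∀ {i} → P i → i ≤ m)

maximum : {P : Pred (Fin N) 0ℓ} → Decidable P → ∃ P → ∃ (IsMaximum P)
maximum {suc N} {P} P? (i , pi) with any? (P? ∘ suc)
... | yes e with m , pm , ub ← maximum (P? ∘ suc) e =
  suc m , pm , λ { {zero} _ → z≤n ; {suc j} pj → s≤s (ub pj) }
... | no ¬e = zero , p₀ i pi , λ { {zero} _ → z≤n ; {suc j} pj → contradiction (j , pj) ¬e }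
  where
  p₀ : ∀ i → P i → P zero
  p₀ zero    p = p
  p₀ (suc j) p = contradiction (j , p) ¬e

maximum-unique : {P : Pred (Fin N) 0ℓ} {l m : Fin N} →
                 IsMaximum P l → IsMaximum P m → l ≡ m
maximum-unique (pl , l-ub) (pm , m-ub) = ≤-antisym (m-ub pl) (l-ub pm)

-- Subsets given by decidable predicates

comprehension : {P : Pred (Fin N) 0ℓ} → Decidable P → Subset N
comprehension P? = tabulate (does ∘ P?)

module _ {P : Pred (Fin N) 0ℓ} (P? : Decidable P) {i : Fin N} where

  ∈-comprehension⁺ : P i → i ∈ comprehension P?
  ∈-comprehension⁺ p =
    lookup⇒[]= i _ (trans (lookup∘tabulate (does ∘ P?) i) (dec-true (P? i) p))

  ∈-comprehension⁻ : i ∈ comprehension P? → P i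
  ∈-comprehension⁻ i∈ with P? i | trans (sym (lookup∘tabulate (does ∘ P?) i)) ([]=⇒lookup i∈)
  ... | yes p | _  = p
  ... | no _  | ()

-- Permutations of Fin N

-- If `y` were missed, `punchOut` at `y` would turn `f` into an injection from `Fin (suc N)` into
-- `Fin N`.
injective⇒surjective : {f : Fin N → Fin N} → Injective _≡_ _≡_ f → ∀ y → ∃ λ x → f x ≡ y
injective⇒surjective {suc N} {f} inj y with any? (λ x → f x ≟ y)
... | yes e = e
... | no ¬e = contradiction (injective⇒≤ {f = g} g-injective) ℕ.1+n≰n
  where
  y≢f : ∀ x → y ≢ f x
  y≢f x eq = ¬e (x , sym eq)
  g : Fin (suc N) → Fin N
  g x = punchOut (y≢f x)
  g-injective : Injective _≡_ _≡_ g
  g-injective {i} {j} eq = inj (punchOut-injective (y≢f i) (y≢f j) eq)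

-- Sorting by a strict total order

module Sorting {_≺_ : Rel (Fin N) 0ℓ} (irrefl : ∀ {i} → ¬ (i ≺ i))
               (≺-trans : Transitive _≺_)
               (connex : ∀ {i j} → i ≢ j → i ≺ j ⊎ j ≺ i) where

  _≺?_ : ∀ i j → Dec (i ≺ j)
  i ≺? j with i ≟ j
  ... | yes refl = no irrefl
  ... | no i≢j   = [ yes , (λ j≺i → no λ i≺j → irrefl (≺-trans i≺j j≺i)) ]′ (connex i≢j)

  predecessors : Fin N → Subset N
  predecessors i = comprehension (_≺? i)

  ∣predecessors∣<N : ∀ i → ∣ predecessors i ∣ ℕ.< N
  ∣predecessors∣<N i = subst (∣ predecessors i ∣ ℕ.<_) (∣⊤∣≡n N)
    (p⊂q⇒∣p∣<∣q∣ (⊆⊤ , i , ∈⊤ , irrefl ∘ ∈-comprehension⁻ (_≺? i)))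

  rank : Fin N → Fin N
  rank i = fromℕ< (∣predecessors∣<N i)

  rank-mono : ∀ {i j} → i ≺ j → rank i < rank j
  rank-mono {i} {j} i≺j = subst₂ ℕ._<_ (sym (toℕ-fromℕ< _)) (sym (toℕ-fromℕ< _))
    (p⊂q⇒∣p∣<∣q∣
      ( (λ k∈ → ∈-comprehension⁺ (_≺? j) (≺-trans (∈-comprehension⁻ (_≺? i) k∈) i≺j))
      , i , ∈-comprehension⁺ (_≺? j) i≺j , irrefl ∘ ∈-comprehension⁻ (_≺? i)))

  rank-injective : Injective _≡_ _≡_ rank
  rank-injective {i} {j} eq with i ≟ j
  ... | yes i≡j = i≡j
  ... | no i≢j  = [ (λ i≺j → contradiction eq (<⇒≢ (rank-mono i≺j)))
                  , (λ j≺i → contradiction (sym eq) (<⇒≢ (rank-mono j≺i))) ]′ (connex i≢j)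

  sorted : Permutation′ N
  -- A permutation sends positions to values, so the word is the inverse of `rank`, and
  -- `sorted ⟨$⟩ˡ i` is `rank i`.
  sorted = permutation (proj₁ ∘ onto) rank
             (λ i → rank-injective (proj₂ (onto (rank i)))) (proj₂ ∘ onto)
    where onto = injective⇒surjective rank-injective

  sorted-reflects : ∀ {i j} → sorted ⟨$⟩ˡ i < sorted ⟨$⟩ˡ j → i ≺ j
  sorted-reflects {i} {j} r with i ≟ j
  ... | yes refl = contradiction r (ℕ.<-irrefl refl)
  ... | no i≢j   = [ id , (λ j≺i → contradiction (<-trans r (rank-mono j≺i)) (ℕ.<-irrefl refl)) ]′
                     (connex i≢j)

-- Words determined by the relative order of positions

increasing⇒inflationary : {M : ℕ} {f : Fin N → Fin M} → (∀ {i j} → i < j → f i < f j) →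
                          ∀ i → i ≤ f i
increasing⇒inflationary {suc N} {f = f} mono = <-weakInduction (λ i → i ≤ f i) z≤n
  λ i i≤fi → ℕ.≤-<-trans (subst (ℕ._≤ toℕ (f (inject₁ i))) (toℕ-inject₁ i) i≤fi)
                         (mono (s≤s (ℕ.≤-reflexive (toℕ-inject₁ i))))

module _ (π : Permutation′ N) where

  ⟨$⟩ˡ-injective : ∀ {i j} → π ⟨$⟩ˡ i ≡ π ⟨$⟩ˡ j → i ≡ j
  ⟨$⟩ˡ-injective eq = trans (sym (inverseʳ π)) (trans (cong (π ⟨$⟩ʳ_) eq) (inverseʳ π))

-- The map from positions in `π` to positions in `σ` of the same values is strictly increasing, and
-- so is its inverse. Neither can fall below the identity, so both are the identity.
≗-from-order : (π σ : Permutation′ N) →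
               (∀ {i j} → π ⟨$⟩ˡ i < π ⟨$⟩ˡ j → σ ⟨$⟩ˡ i < σ ⟨$⟩ˡ j) →
               (π ⟨$⟩ʳ_) ≗ (σ ⟨$⟩ʳ_)
≗-from-order π σ π⇒σ x =
  trans (sym (inverseʳ σ)) (cong (σ ⟨$⟩ʳ_) (≤-antisym below (above x)))
  where
  σ⇒π : ∀ {i j} → σ ⟨$⟩ˡ i < σ ⟨$⟩ˡ j → π ⟨$⟩ˡ i < π ⟨$⟩ˡ j
  σ⇒π {i} {j} r with <-cmp (π ⟨$⟩ˡ i) (π ⟨$⟩ˡ j)
  ... | tri< p _ _ = p
  ... | tri≈ _ e _ = contradiction r (ℕ.<-irrefl (cong (λ k → toℕ (σ ⟨$⟩ˡ k)) (⟨$⟩ˡ-injective π e)))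
  ... | tri> _ _ q = contradiction (<-trans r (π⇒σ q)) (ℕ.<-irrefl refl)
  above : ∀ x → x ≤ σ ⟨$⟩ˡ (π ⟨$⟩ʳ x)
  above = increasing⇒inflationary λ i<j →
    π⇒σ (subst₂ _<_ (sym (inverseˡ π)) (sym (inverseˡ π)) i<j)
  below : σ ⟨$⟩ˡ (π ⟨$⟩ʳ x) ≤ x
  below = subst (σ ⟨$⟩ˡ (π ⟨$⟩ʳ x) ≤_)
    (trans (cong (π ⟨$⟩ˡ_) (inverseʳ σ)) (inverseˡ π))
    (increasing⇒inflationary
      (λ i<j → σ⇒π (subst₂ _<_ (sym (inverseˡ σ)) (sym (inverseˡ σ)) i<j)) (σ ⟨$⟩ˡ (π ⟨$⟩ʳ x)))

-- Induction on `q`: either the last step up to `q` is an ascent, or the value just before `q` is at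
-- least `f q`, hence still above `f p`, and the search moves one place back.
ascent : (f : Fin N → Fin N) {p q : Fin N} → p < q → f p < f q →
         ∃₂ λ r s → p ≤ r × toℕ s ≡ suc (toℕ r) × s ≤ q × f r < f s
ascent {suc N} f {p} {q} = <-weakInduction
  (λ q → p < q → f p < f q → ∃₂ λ r s → p ≤ r × toℕ s ≡ suc (toℕ r) × s ≤ q × f r < f s)
  (λ ()) step q
  where
  step : ∀ q → (p < inject₁ q → f p < f (inject₁ q) →
                ∃₂ λ r s → p ≤ r × toℕ s ≡ suc (toℕ r) × s ≤ inject₁ q × f r < f s) →
         p < suc q → f p < f (suc q) →
         ∃₂ λ r s → p ≤ r × toℕ s ≡ suc (toℕ r) × s ≤ suc q × f r < f s
  step q ih p<q fp<fq with f (inject₁ q) <? f (suc q)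
  ... | yes a = inject₁ q , suc q , p≤q , cong suc (sym (toℕ-inject₁ q)) , ℕ.≤-refl , a
    where
    p≤q : p ≤ inject₁ q
    p≤q = subst (toℕ p ℕ.≤_) (sym (toℕ-inject₁ q)) (ℕ.≤-pred p<q)
  ... | no ¬a =
    let r , s , p≤r , s≡ , s≤q , rs = ih (≤∧≢⇒< p≤q λ { refl → ¬a fp<fq }) (ℕ.<-≤-trans fp<fq (ℕ.≮⇒≥ ¬a))
    in r , s , p≤r , s≡ , ℕ.≤-trans s≤q (ℕ.≤-trans (ℕ.≤-reflexive (toℕ-inject₁ q)) (ℕ.n≤1+n _)) , rs
    where
    p≤q : p ≤ inject₁ q
    p≤q = subst (toℕ p ℕ.≤_) (sym (toℕ-inject₁ q)) (ℕ.≤-pred p<q)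

-- A key consists of the colour, the head and the value itself; the order ◁ on
-- keys is the order in which an avoider lists its values.

Key : ℕ → Set
Key N = Colour × Fin N × Fin N

infix 4 _◁_

_◁_ : Rel (Key N) 0ℓ
(left  , a , i) ◁ (left  , b , j) = a < b ⊎ (a ≡ b × j < i)
(left  , a , i) ◁ (right , b , j) = Unit
(right , a , i) ◁ (left  , b , j) = ⊥
(right , a , i) ◁ (right , b , j) = b < a ⊎ (a ≡ b × i ≢ a × (j ≡ b ⊎ j < i))

◁-irrefl : {k : Key N} → ¬ (k ◁ k)
◁-irrefl {k = left  , a , i} (inj₁ a<a)                        = ℕ.<-irrefl refl a<a
◁-irrefl {k = left  , a , i} (inj₂ (_ , i<i))                  = ℕ.<-irrefl refl i<i
◁-irrefl {k = right , a , i} (inj₁ a<a)                        = ℕ.<-irrefl refl a<a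
◁-irrefl {k = right , a , i} (inj₂ (_ , i≢a , inj₁ i≡a))       = i≢a i≡a
◁-irrefl {k = right , a , i} (inj₂ (_ , _   , inj₂ i<i))       = ℕ.<-irrefl refl i<i

◁-trans : Transitive (_◁_ {N})
◁-trans {i = left  , _} {left  , _} {left  , _} (inj₁ a<b)          (inj₁ b<c)          = inj₁ (<-trans a<b b<c)
◁-trans {i = left  , _} {left  , _} {left  , _} (inj₁ a<b)          (inj₂ (refl , _))   = inj₁ a<b
◁-trans {i = left  , _} {left  , _} {left  , _} (inj₂ (refl , _))   (inj₁ b<c)          = inj₁ b<c
◁-trans {i = left  , _} {left  , _} {left  , _} (inj₂ (refl , j<i)) (inj₂ (refl , k<j)) =
  inj₂ (refl , <-trans k<j j<i)
◁-trans {i = left  , _} {left  , _} {right , _} _ _ = tt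
◁-trans {i = left  , _} {right , _} {right , _} _ _ = tt
◁-trans {i = right , _} {right , _} {right , _} (inj₁ b<a)         (inj₁ c<b)       = inj₁ (<-trans c<b b<a)
◁-trans {i = right , _} {right , _} {right , _} (inj₁ b<a)         (inj₂ (refl , _)) = inj₁ b<a
◁-trans {i = right , _} {right , _} {right , _} (inj₂ (refl , _))  (inj₁ c<b)       = inj₁ c<b
-- The middle value is the head, which closes its right block; nothing of that block can follow it.
◁-trans {i = right , _} {right , _} {right , _} (inj₂ (refl , i≢a , inj₁ j≡a)) (inj₂ (refl , j≢a , _)) =
  contradiction j≡a j≢a
◁-trans {i = right , _} {right , _} {right , _} (inj₂ (refl , i≢a , inj₂ j<i)) (inj₂ (refl , _ , inj₁ k≡a)) =
  inj₂ (refl , i≢a , inj₁ k≡a)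
◁-trans {i = right , _} {right , _} {right , _} (inj₂ (refl , i≢a , inj₂ j<i)) (inj₂ (refl , _ , inj₂ k<j)) =
  inj₂ (refl , i≢a , inj₂ (<-trans k<j j<i))

-- Distinct values suffice: where colour and head agree, the values break the tie, the head going
-- first on the left and last on the right.
◁-connex : (k l : Key N) → proj₂ (proj₂ k) ≢ proj₂ (proj₂ l) → k ◁ l ⊎ l ◁ k
◁-connex (left  , a , i) (left  , b , j) i≢j with <-cmp a b
... | tri< a<b _ _ = inj₁ (inj₁ a<b)
... | tri> _ _ b<a = inj₂ (inj₁ b<a)
... | tri≈ _ refl _ with <-cmp i j
...   | tri< i<j _ _ = inj₂ (inj₂ (refl , i<j))
...   | tri≈ _ i≡j _ = contradiction i≡j i≢j
...   | tri> _ _ j<i = inj₁ (inj₂ (refl , j<i))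
◁-connex (left  , _) (right , _) _ = inj₁ tt
◁-connex (right , _) (left  , _) _ = inj₂ tt
◁-connex (right , a , i) (right , b , j) i≢j with <-cmp a b
... | tri< a<b _ _ = inj₂ (inj₁ a<b)
... | tri> _ _ b<a = inj₁ (inj₁ b<a)
... | tri≈ _ refl _ with i ≟ a | j ≟ a | <-cmp i j
...   | yes i≡a | _       | _            = inj₂ (inj₂ (refl , (λ j≡a → i≢j (trans i≡a (sym j≡a))) , inj₁ i≡a))
...   | no i≢a  | yes j≡a | _            = inj₁ (inj₂ (refl , i≢a , inj₁ j≡a))
...   | no i≢a  | no j≢a  | tri< i<j _ _ = inj₂ (inj₂ (refl , j≢a , inj₂ i<j))
...   | no i≢a  | no j≢a  | tri≈ _ i≡j _ = contradiction i≡j i≢j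
...   | no i≢a  | no j≢a  | tri> _ _ j<i = inj₁ (inj₂ (refl , i≢a , inj₂ j<i))

-- The largest value fromℕ n counts as left, so that it is the last left value.
record Code (n : ℕ) : Set where
  field
    colour      : Fin (suc n) → Colour
    head        : Fin (suc n) → Fin (suc n)
    ≤head       : ∀ i → i ≤ head i
    head-head   : ∀ i → head (head i) ≡ head i
    colour-head : ∀ i → colour (head i) ≡ colour i
    colour-top  : colour (fromℕ n) ≡ left
    head-top⁻   : ∀ {i} → head i ≡ fromℕ n → i ≡ fromℕ n

  mark : Fin (suc n) → Colour × Fin (suc n)
  mark i = colour i , head i

  key : Fin (suc n) → Key (suc n)
  key i = colour i , head i , i

  infix 4 _≺_

  _≺_ : Rel (Fin (suc n)) 0ℓ
  i ≺ j = key i ◁ key j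

  ≺-trans : Transitive _≺_
  ≺-trans {i} {j} {k} = ◁-trans {i = key i} {key j} {key k}

  ≺-connex : ∀ {i j} → i ≢ j → i ≺ j ⊎ j ≺ i
  ≺-connex {i} {j} = ◁-connex (key i) (key j)

  ≺-irrefl : ∀ {i} → ¬ (i ≺ i)
  ≺-irrefl {i} = ◁-irrefl {k = key i}

  private
    -- `_◁_` computes only on literal colours, so known colours are first substituted into the keys.
    recolour : ∀ {i j c d c′ d′} → c ≡ c′ → d ≡ d′ →
               (c , head i , i) ◁ (d , head j , j) → (c′ , head i , i) ◁ (d′ , head j , j)
    recolour {i} {j} = subst₂ (λ c d → (c , head i , i) ◁ (d , head j , j))

  left≺ : ∀ {i j} → colour i ≡ left → colour j ≡ left →
          head i < head j ⊎ (head i ≡ head j × j < i) → i ≺ j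
  left≺ ci cj = recolour (sym ci) (sym cj)

  right≺ : ∀ {i j} → colour i ≡ right → colour j ≡ right →
           head j < head i ⊎ (head i ≡ head j × i ≢ head i × (j ≡ head j ⊎ j < i)) → i ≺ j
  right≺ ci cj = recolour (sym ci) (sym cj)

  left≺right : ∀ {i j} → colour i ≡ left → colour j ≡ right → i ≺ j
  left≺right {i} {j} ci cj = recolour {i} {j} (sym ci) (sym cj) tt

  before-left : ∀ {i j} → colour j ≡ left → i ≺ j →
                colour i ≡ left × (head i < head j ⊎ (head i ≡ head j × j < i))
  before-left {i} {j} cj i≺j with left-or-right (colour i)
  ... | inj₁ ci = ci , recolour ci cj i≺j
  ... | inj₂ ci = ⊥-elim (recolour {i} {j} ci cj i≺j)

  after-right : ∀ {i j} → colour i ≡ right → i ≺ j →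
                colour j ≡ right ×
                (head j < head i ⊎ (head i ≡ head j × i ≢ head i × (j ≡ head j ⊎ j < i)))
  after-right {i} {j} ci i≺j with left-or-right (colour j)
  ... | inj₁ cj = ⊥-elim (recolour {i} {j} ci cj i≺j)
  ... | inj₂ cj = cj , recolour ci cj i≺j

  head-mono-left : ∀ {i j} → colour j ≡ left → i ≺ j → head i ≤ head j
  head-mono-left cj i≺j = [ ℕ.<⇒≤ , ≤-reflexive ∘ proj₁ ]′ (proj₂ (before-left cj i≺j))

  head-anti-right : ∀ {i j} → colour i ≡ right → i ≺ j → head j ≤ head i
  head-anti-right ci i≺j = [ ℕ.<⇒≤ , ≤-reflexive ∘ sym ∘ proj₁ ]′ (proj₂ (after-right ci i≺j))

  head-top : head (fromℕ n) ≡ fromℕ n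
  head-top = ≤-antisym (≤fromℕ _) (≤head _)

  ≺top : ∀ {i} → colour i ≡ left → i ≢ fromℕ n → i ≺ fromℕ n
  ≺top {i} ci i≢top = left≺ ci colour-top (inj₁ (subst (head i <_) (sym head-top)
    (≤∧≢⇒< (≤fromℕ _) (i≢top ∘ head-top⁻))))

  -- Some head, or the top, separates `a` from `b`. If `b` is on the left, the larger `c` before it
  -- shows that `b` is not the head of its block, and `a < b` puts `a` in an earlier block; so
  -- `head b`, which opens the block of `b`, lies between them. If `b` is on the right, either `a`
  -- is on the left and the top lies between, or `head a`, which closes the block of `a`, does.
  ascent-not-adjacent : ∀ {a b c d} → c ≺ b → a ≺ b → b ≺ d → a < b → b < c → b < d →
                       ∃ λ x → a ≺ x × x ≺ b
  ascent-not-adjacent {a} {b} {c} {d} c≺b a≺b b≺d a<b b<c b<d with left-or-right (colour b)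
  ascent-not-adjacent {a} {b} {c} {d} c≺b a≺b b≺d a<b b<c b<d | inj₁ cb
    with before-left cb a≺b
  ... | _  , inj₂ (_ , b<a) = contradiction (<-trans a<b b<a) (ℕ.<-irrefl refl)
  ... | ca , inj₁ ha<hb     =
    head b
    , left≺ ca chb (inj₁ (subst (head a <_) (sym (head-head b)) ha<hb))
    , left≺ chb cb (inj₂ (head-head b
                         , ℕ.<-≤-trans b<c (ℕ.≤-trans (≤head c) (head-mono-left cb c≺b))))
    where chb = trans (colour-head b) cb
  ascent-not-adjacent {a} {b} {c} {d} c≺b a≺b b≺d a<b b<c b<d | inj₂ cb
    with left-or-right (colour a)
  ... | inj₁ ca = fromℕ n
    , ≺top ca (λ { refl → ℕ.<⇒≱ a<b (≤fromℕ b) })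
    , left≺right colour-top cb
  ... | inj₂ ca with after-right ca a≺b
  ...   | _ , inj₂ (_ , _ , inj₂ b<a)  = contradiction (<-trans a<b b<a) (ℕ.<-irrefl refl)
  -- In one right block, `b` could exceed the earlier `a` only as the head; the larger `d` after `b`
  -- rules this out.
  ...   | _ , inj₂ (_ , _ , inj₁ b≡hb) = contradiction b≡hb (<⇒≢
            (ℕ.<-≤-trans b<d (ℕ.≤-trans (≤head d) (head-anti-right cb b≺d))))
  ...   | _ , inj₁ hb<ha =
    head a
    , right≺ ca cha (inj₂ (sym (head-head a) , <⇒≢ a<ha , inj₁ (sym (head-head a))))
    , right≺ cha cb (inj₁ (subst (head b <_) (sym (head-head a)) hb<ha))
    where
    cha  = trans (colour-head a) ca
    a<ha = <-trans a<b (ℕ.≤-<-trans (≤head b) hb<ha)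

open Code using (mark)

Codes : ℕ → Setoid 0ℓ 0ℓ
Codes n = On.setoid {B = Code n} (Fin (suc n) →-setoid (Colour × Fin (suc n))) mark

-- Codes of permutations

module _ (π : Permutation′ (suc n)) where

  private
    pos : Fin (suc n) → Fin (suc n)
    pos = π ⟨$⟩ˡ_

    pos-injective : ∀ {i j} → pos i ≡ pos j → i ≡ j
    pos-injective = ⟨$⟩ˡ-injective π

    top : Fin (suc n)
    top = fromℕ n

  data Side (i : Fin (suc n)) : Colour → Set where
    onLeft  : pos i ≤ pos top → Side i left
    onRight : pos top < pos i → Side i right

  -- The segment of the word from `i` outwards, away from the top; the head is the maximum over it.
  Reach : Colour → Fin (suc n) → Fin (suc n) → Set
  Reach left  i j = pos j ≤ pos i
  Reach right i j = pos i ≤ pos j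

  Reach? : ∀ c i → Decidable (Reach c i)
  Reach? left  i j = pos j ≤? pos i
  Reach? right i j = pos i ≤? pos j

  Reach-refl : ∀ c i → Reach c i i
  Reach-refl left  i = ℕ.≤-refl
  Reach-refl right i = ℕ.≤-refl

  Reach-trans : ∀ c {i j k} → Reach c i j → Reach c j k → Reach c i k
  Reach-trans left  j≤i k≤j = ℕ.≤-trans k≤j j≤i
  Reach-trans right i≤j j≤k = ℕ.≤-trans i≤j j≤k

  side : ∀ i → ∃ (Side i)
  side i with pos i ≤? pos top
  ... | yes i≤top = left , onLeft i≤top
  ... | no  i≰top = right , onRight (ℕ.≰⇒> i≰top)

  Side-unique : ∀ {i c d} → Side i c → Side i d → c ≡ d
  Side-unique (onLeft _)  (onLeft _)  = refl
  Side-unique (onRight _) (onRight _) = refl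
  Side-unique (onLeft p)  (onRight q) = contradiction p (ℕ.<⇒≱ q)
  Side-unique (onRight q) (onLeft p)  = contradiction p (ℕ.<⇒≱ q)

  Side-reach : ∀ {i j c} → Side i c → Reach c i j → Side j c
  Side-reach (onLeft i≤top)  j≤i = onLeft (ℕ.≤-trans j≤i i≤top)
  Side-reach (onRight top<i) i≤j = onRight (ℕ.<-≤-trans top<i i≤j)

  -- A relation rather than a function: a code computed from `π` and one obtained otherwise can then
  -- be identified through uniqueness of sides and of maxima.
  record IsCode (κ : Code n) : Set where
    open Code κ
    field
      colour-side : ∀ i → Side i (colour i)
      head-max    : ∀ i → IsMaximum (Reach (colour i) i) (head i)

  open IsCode

  IsCode-unique : ∀ {κ μ} → IsCode κ → IsCode μ → mark κ ≗ mark μ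
  IsCode-unique {κ} {μ} κ-is μ-is i = cong₂ _,_ colour≡
    (maximum-unique (head-max κ-is i)
      (subst (λ c → IsMaximum (Reach c i) (Code.head μ i)) (sym colour≡) (head-max μ-is i)))
    where
    colour≡ : Code.colour κ i ≡ Code.colour μ i
    colour≡ = Side-unique (colour-side κ-is i) (colour-side μ-is i)

  permCode : Σ (Code n) IsCode
  permCode = κ , record { colour-side = colour-side′ ; head-max = head-max′ }
    where
    colour′ : Fin (suc n) → Colour
    colour′ i = proj₁ (side i)

    colour-side′ : ∀ i → Side i (colour′ i)
    colour-side′ i = proj₂ (side i)

    furthest : ∀ i → ∃ (IsMaximum (Reach (colour′ i) i))
    furthest i = maximum (Reach? (colour′ i) i) (i , Reach-refl (colour′ i) i)

    head′ : Fin (suc n) → Fin (suc n)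
    head′ i = proj₁ (furthest i)

    head-max′ : ∀ i → IsMaximum (Reach (colour′ i) i) (head′ i)
    head-max′ i = proj₂ (furthest i)

    ≤head′ : ∀ i → i ≤ head′ i
    ≤head′ i = proj₂ (head-max′ i) (Reach-refl (colour′ i) i)

    colour-head′ : ∀ i → colour′ (head′ i) ≡ colour′ i
    colour-head′ i = Side-unique (colour-side′ (head′ i))
      (Side-reach (colour-side′ i) (proj₁ (head-max′ i)))

    head-head′ : ∀ i → head′ (head′ i) ≡ head′ i
    head-head′ i = ≤-antisym
      -- The head of `head′ i` is itself reached from `i`, hence bounded by `head′ i`.
      (proj₂ (head-max′ i) (Reach-trans (colour′ i) (proj₁ (head-max′ i))
        (subst (λ c → Reach c (head′ i) (head′ (head′ i))) (colour-head′ i)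
          (proj₁ (head-max′ (head′ i))))))
      (≤head′ (head′ i))

    top-reached⇒top : ∀ {i c} → Side i c → Reach c i top → i ≡ top
    top-reached⇒top (onLeft i≤top)  top≤i = pos-injective (≤-antisym i≤top top≤i)
    top-reached⇒top (onRight top<i) i≤top = contradiction i≤top (ℕ.<⇒≱ top<i)

    κ : Code n
    κ = record
      { colour      = colour′
      ; head        = head′
      ; ≤head       = ≤head′
      ; head-head   = head-head′
      ; colour-head = colour-head′
      ; colour-top  = Side-unique (colour-side′ top) (onLeft ℕ.≤-refl)
      ; head-top⁻   = λ {i} eq → top-reached⇒top (colour-side′ i)
                        (subst (Reach (colour′ i) i) eq (proj₁ (head-max′ i)))
      }

  -- A word sorted by a code has that code

  Sorts : Code n → Set
  Sorts κ = ∀ {i j} → pos i < pos j → Code._≺_ κ i j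

  Sorts⁻¹ : (κ : Code n) → Sorts κ → ∀ {i j} → Code._≺_ κ i j → pos i < pos j
  Sorts⁻¹ κ sorts {i} {j} i≺j with <-cmp (pos i) (pos j)
  ... | tri< i<j _ _ = i<j
  ... | tri≈ _ eq _ with refl ← pos-injective eq = contradiction i≺j (Code.≺-irrefl κ {i})
  ... | tri> _ _ j<i =
    contradiction (Code.≺-trans κ {i} {j} {i} i≺j (sorts j<i)) (Code.≺-irrefl κ {i})

  -- The top is the last left value, which settles the sides. A head opens its left block or closes
  -- its right block, so it is reached from every member; heads grow towards the top, so everything
  -- reached from `i` is at most `head i`.
  Sorts⇒IsCode : (κ : Code n) → Sorts κ → IsCode κ
  Sorts⇒IsCode κ sorts = record { colour-side = colour-side′ ; head-max = head-max′ }
    where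
    open Code κ

    sorts⁻¹ : ∀ {i j} → i ≺ j → pos i < pos j
    sorts⁻¹ = Sorts⁻¹ κ sorts

    colour-side′ : ∀ i → Side i (colour i)
    colour-side′ i with colour i in ci
    ... | right = onRight (sorts⁻¹ (left≺right colour-top ci))
    ... | left with i ≟ top
    ...   | yes refl = onLeft ℕ.≤-refl
    ...   | no i≢top = onLeft (ℕ.<⇒≤ (sorts⁻¹ (≺top ci i≢top)))

    pos-≤⇒≡⊎≺ : ∀ {i j} → pos i ≤ pos j → i ≡ j ⊎ i ≺ j
    pos-≤⇒≡⊎≺ {i} {j} i≤j with i ≟ j
    ... | yes i≡j = inj₁ i≡j
    ... | no i≢j  = inj₂ (sorts (≤∧≢⇒< i≤j (i≢j ∘ pos-injective)))

    head-reached : ∀ i c → colour i ≡ c → Reach c i (head i)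
    head-reached i c ci with i ≟ head i
    ... | yes i≡h = subst (Reach c i) i≡h (Reach-refl c i)
    head-reached i left  ci | no i≢h = ℕ.<⇒≤ (sorts⁻¹
      (left≺ (trans (colour-head i) ci) ci (inj₂ (head-head i , ≤∧≢⇒< (≤head i) i≢h))))
    head-reached i right ci | no i≢h = ℕ.<⇒≤ (sorts⁻¹
      (right≺ ci (trans (colour-head i) ci) (inj₂ (sym (head-head i) , i≢h , inj₁ (sym (head-head i))))))

    head-bound : ∀ i c → colour i ≡ c → ∀ {j} → Reach c i j → j ≤ head i
    head-bound i left ci {j} j≤i with pos-≤⇒≡⊎≺ j≤i
    ... | inj₁ refl = ≤head i
    ... | inj₂ j≺i  = ℕ.≤-trans (≤head j) (head-mono-left ci j≺i)
    head-bound i right ci {j} i≤j with pos-≤⇒≡⊎≺ i≤j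
    ... | inj₁ refl = ≤head i
    ... | inj₂ i≺j  = ℕ.≤-trans (≤head j) (head-anti-right ci i≺j)

    head-max′ : ∀ i → IsMaximum (Reach (colour i) i) (head i)
    head-max′ i = head-reached i (colour i) refl , head-bound i (colour i) refl

  -- From sortedness to avoidance

  Sorts⇒Avoids : (κ : Code n) → Sorts κ → Avoids 3-12-3 π
  Sorts⇒Avoids κ sorts o =
    let x , a≺x , x≺b = ascent-not-adjacent
          (precedes 0F 2F (s≤s z≤n)) (precedes 1F 2F (s≤s (s≤s z≤n))) (precedes 2F 3F (s≤s (s≤s (s≤s z≤n))))
          (ordered 2F 1F (s≤s (s≤s z≤n))) (ordered 0F 2F (s≤s (s≤s (s≤s z≤n)))) (ordered 3F 2F (s≤s (s≤s (s≤s z≤n))))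
        a<x = subst (_< pos x) (inverseˡ π) (Sorts⁻¹ κ sorts a≺x)
        x<b = subst (pos x <_) (inverseˡ π) (Sorts⁻¹ κ sorts x≺b)
    -- No position is left for the separating value `x`: those of `a` and `b` are consecutive.
    in ℕ.<⇒≱ a<x (ℕ.≤-pred (subst (toℕ (pos x) ℕ.<_) (adjacent 1F refl) x<b))
    where
    open Occurrence o
    open Code κ
    precedes : ∀ k l → k < l → π ⟨$⟩ʳ position k ≺ π ⟨$⟩ʳ position l
    precedes k l k<l = sorts (subst₂ _<_ (sym (inverseˡ π)) (sym (inverseˡ π)) (increasing k l k<l))

  -- From avoidance to sortedness

  3-12-3-occurrence : ∀ {c r s d} → pos c < r → toℕ s ≡ suc (toℕ r) → s < pos d →
                      π ⟨$⟩ʳ r < π ⟨$⟩ʳ s → π ⟨$⟩ʳ s < c → π ⟨$⟩ʳ s < d →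
                      Occurrence 3-12-3 π
  3-12-3-occurrence {c} {r} {s} {d} c<r s≡ s<d a<b b<c b<d = record
    { position = position ; increasing = increasing ; ordered = ordered ; adjacent = adjacent }
    where
    open Pattern 3-12-3

    position : Fin 4 → Fin (suc n)
    position 0F = pos c
    position 1F = r
    position 2F = s
    position 3F = pos d

    r<s : r < s
    r<s = ℕ.≤-reflexive (sym s≡)

    increasing : ∀ i j → i < j → position i < position j
    increasing 0F 1F _ = c<r
    increasing 0F 2F _ = <-trans c<r r<s
    increasing 0F 3F _ = <-trans (<-trans c<r r<s) s<d
    increasing 1F 2F _ = r<s
    increasing 1F 3F _ = <-trans r<s s<d
    increasing 2F 3F _ = s<d
    increasing (suc _)       1F (s≤s ())
    increasing (suc (suc _)) 2F (s≤s (s≤s ()))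
    increasing 3F            3F (s≤s (s≤s (s≤s ())))

    b<c′ : π ⟨$⟩ʳ s < π ⟨$⟩ʳ pos c
    b<c′ = subst (π ⟨$⟩ʳ s <_) (sym (inverseʳ π)) b<c

    b<d′ : π ⟨$⟩ʳ s < π ⟨$⟩ʳ pos d
    b<d′ = subst (π ⟨$⟩ʳ s <_) (sym (inverseʳ π)) b<d

    ordered : ∀ i j → Vec.lookup letters i ℕ.> Vec.lookup letters j →
              π ⟨$⟩ʳ position j < π ⟨$⟩ʳ position i
    ordered 0F 1F _ = <-trans a<b b<c′
    ordered 0F 2F _ = b<c′
    ordered 2F 1F _ = a<b
    ordered 3F 1F _ = <-trans a<b b<d′
    ordered 3F 2F _ = b<d′
    ordered 0F 0F (s≤s (s≤s (s≤s ())))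
    ordered 0F 3F (s≤s (s≤s (s≤s ())))
    ordered 1F 0F (s≤s ())
    ordered 1F 1F (s≤s ())
    ordered 1F 2F (s≤s ())
    ordered 1F 3F (s≤s ())
    ordered 2F 0F (s≤s (s≤s ()))
    ordered 2F 2F (s≤s (s≤s ()))
    ordered 2F 3F (s≤s (s≤s ()))
    ordered 3F 0F (s≤s (s≤s (s≤s ())))
    ordered 3F 3F (s≤s (s≤s (s≤s ())))

    adjacent : ∀ i → Vec.lookup dashed i ≡ false →
               toℕ (position (suc i)) ≡ suc (toℕ (position (inject₁ i)))
    adjacent 1F _ = s≡
    adjacent 0F ()
    adjacent 2F ()

  -- Across blocks the order follows from nested segments having ordered maxima. Within a block, a
  -- pair in the wrong order yields an adjacent ascent, and the head and the top then serve as the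
  -- two 3s.
  IsCode∧Avoids⇒Sorts : (κ : Code n) → IsCode κ → Avoids 3-12-3 π → Sorts κ
  IsCode∧Avoids⇒Sorts κ κ-is avoids = sorts
    where
    open Code κ

    onLeft⁻ : ∀ {i} → colour i ≡ left → pos i ≤ pos top
    onLeft⁻ {i} ci with onLeft i≤top ← subst (Side i) ci (colour-side κ-is i) = i≤top

    onRight⁻ : ∀ {i} → colour i ≡ right → pos top < pos i
    onRight⁻ {i} ci with onRight top<i ← subst (Side i) ci (colour-side κ-is i) = top<i

    reached : ∀ {i c} → colour i ≡ c → Reach c i (head i)
    reached {i} refl = proj₁ (head-max κ-is i)

    bound : ∀ {i j c} → colour i ≡ c → Reach c i j → j ≤ head i
    bound {i} refl = proj₂ (head-max κ-is i)

    pos≢⇒≢ : ∀ {p v} → pos v ≢ p → π ⟨$⟩ʳ p ≢ v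
    pos≢⇒≢ pos≢ refl = pos≢ (inverseˡ π)

    ≢⇒pos≢ : ∀ {p v} → π ⟨$⟩ʳ p ≢ v → pos v ≢ p
    ≢⇒pos≢ ≢v refl = ≢v (inverseʳ π)

    ascent-between : ∀ {i j} → pos i < pos j → i < j →
                     ∃₂ λ r s → pos i ≤ r × toℕ s ≡ suc (toℕ r) × s ≤ pos j ×
                                π ⟨$⟩ʳ r < π ⟨$⟩ʳ s
    ascent-between i<j i<j′ =
      ascent (π ⟨$⟩ʳ_) i<j (subst₂ _<_ (sym (inverseʳ π)) (sym (inverseʳ π)) i<j′)

    -- The common head, standing at or before `i`, is the first 3, and the top is the second.
    left-block-decreases : ∀ {i j} → colour i ≡ left → colour j ≡ left → head i ≡ head j →
                           pos i < pos j → ¬ (i < j)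
    left-block-decreases {i} {j} ci cj hi≡hj i<j i<j′
      with r , s , i≤r , s≡ , s≤j , a<b ← ascent-between i<j i<j′ =
      avoids (3-12-3-occurrence h<r s≡ s<top a<b b<h (ℕ.<-≤-trans b<h (≤fromℕ (head j))))
      where
      h≤r : pos (head j) ≤ r
      h≤r = subst (λ h → pos h ≤ r) hi≡hj (ℕ.≤-trans (reached ci) i≤r)
      b<h : π ⟨$⟩ʳ s < head j
      b<h = ≤∧≢⇒< (bound cj (subst (_≤ pos j) (sym (inverseˡ π)) s≤j))
                  (pos≢⇒≢ (<⇒≢ (ℕ.≤-<-trans h≤r (ℕ.≤-reflexive (sym s≡)))))
      h<r : pos (head j) < r
      h<r = ≤∧≢⇒< h≤r (≢⇒pos≢ (<⇒≢ (<-trans a<b b<h)))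
      j≢top : j ≢ top
      -- If `j` were the top, the common head would be the top too, forcing `i` to equal `j`.
      j≢top refl with refl ← head-top⁻ (trans hi≡hj head-top) = ℕ.<-irrefl refl i<j
      s<top : s < pos top
      s<top = ℕ.≤-<-trans s≤j (≤∧≢⇒< (onLeft⁻ cj) (j≢top ∘ pos-injective))

    -- The roles are mirrored: the top is the first 3 and the common head the second. The case of
    -- `j` being the head is set aside, since the head would then not stand strictly after the
    -- ascent found.
    right-block-decreases : ∀ {i j} → colour i ≡ right → colour j ≡ right → head i ≡ head j →
                            pos i < pos j → j ≢ head j → ¬ (i < j)
    right-block-decreases {i} {j} ci cj hi≡hj i<j j≢h i<j′
      with r , s , i≤r , s≡ , s≤j , a<b ← ascent-between i<j i<j′ =
      avoids (3-12-3-occurrence (ℕ.<-≤-trans (onRight⁻ ci) i≤r) s≡ s<h a<b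
        (ℕ.<-≤-trans b<h (≤fromℕ (head j))) b<h)
      where
      s<h : s < pos (head j)
      s<h = ℕ.≤-<-trans s≤j (≤∧≢⇒< (reached cj) (j≢h ∘ pos-injective))
      r≤s : r ≤ s
      r≤s = ℕ.≤-trans (ℕ.n≤1+n _) (ℕ.≤-reflexive (sym s≡))
      b<h : π ⟨$⟩ʳ s < head j
      b<h = ≤∧≢⇒< (subst (π ⟨$⟩ʳ s ≤_) hi≡hj
                    (bound ci (subst (pos i ≤_) (sym (inverseˡ π)) (ℕ.≤-trans i≤r r≤s))))
                  (pos≢⇒≢ (<⇒≢ s<h ∘ sym))

    sorts : Sorts κ
    sorts {i} {j} i<j with left-or-right (colour i) | left-or-right (colour j)
    ... | inj₁ ci | inj₂ cj = left≺right ci cj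
    ... | inj₂ ci | inj₁ cj = contradiction (<-trans (onRight⁻ ci) i<j) (ℕ.≤⇒≯ (onLeft⁻ cj))
    ... | inj₁ ci | inj₁ cj with head i ≟ head j
    -- `head i` stands at or before `i`, hence before `j`, so `head j` bounds it.
    ...   | no hi≢hj  = left≺ ci cj (inj₁ (≤∧≢⇒< (bound cj (ℕ.≤-trans (reached ci) (ℕ.<⇒≤ i<j))) hi≢hj))
    ...   | yes hi≡hj = left≺ ci cj (inj₂ (hi≡hj , ≤∧≢⇒<
      (ℕ.≮⇒≥ (left-block-decreases ci cj hi≡hj i<j)) (λ { refl → ℕ.<-irrefl refl i<j })))
    sorts {i} {j} i<j | inj₂ ci | inj₂ cj with head i ≟ head j
    ...   | no hi≢hj  = right≺ ci cj (inj₁ (≤∧≢⇒< (bound ci (ℕ.≤-trans (ℕ.<⇒≤ i<j) (reached cj))) (hi≢hj ∘ sym)))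
    ...   | yes hi≡hj = right≺ ci cj (inj₂ (hi≡hj , i≢hi , j-last-or-smaller))
      where
      i≢hi : i ≢ head i
      -- A right head stands at or after every member of its block, whereas `j` comes after `i`.
      i≢hi i≡hi = ℕ.<⇒≱ i<j (subst (λ v → pos j ≤ pos v) (sym (trans i≡hi hi≡hj)) (reached cj))
      j-last-or-smaller : j ≡ head j ⊎ j < i
      j-last-or-smaller with j ≟ head j
      ... | yes j≡hj = inj₁ j≡hj
      ... | no j≢hj  = inj₂ (≤∧≢⇒< (ℕ.≮⇒≥ (right-block-decreases ci cj hi≡hj i<j j≢hj))
                                   (λ { refl → ℕ.<-irrefl refl i<j }))

-- The bijection between avoiders and codes

Sorts-resp-≗ : (π σ : Permutation′ (suc n)) → (π ⟨$⟩ʳ_) ≗ (σ ⟨$⟩ʳ_) →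
               (κ : Code n) → Sorts σ κ → Sorts π κ
Sorts-resp-≗ π σ π≗σ κ sorts i<j = sorts (subst₂ _<_ (pos≡ _) (pos≡ _) i<j)
  where
  pos≡ : (π ⟨$⟩ˡ_) ≗ (σ ⟨$⟩ˡ_)
  pos≡ i = trans (cong (π ⟨$⟩ˡ_) (trans (sym (inverseʳ σ)) (sym (π≗σ _)))) (inverseˡ π)

≺-resp-mark : (κ μ : Code n) → mark κ ≗ mark μ → ∀ {i j} → Code._≺_ κ i j → Code._≺_ μ i j
≺-resp-mark κ μ κ≗μ {i} {j} = subst₂ _◁_ (key≡ i) (key≡ j)
  where
  key≡ : ∀ i → Code.key κ i ≡ Code.key μ i
  key≡ i = cong (λ (c , h) → c , h , i) (κ≗μ i)

avoiders⤖codes : (n : ℕ) → Bijection (Avoiders 3-12-3 (suc n)) (Codes n)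
avoiders⤖codes n = record
  { to        = code
  -- The code of `y` sorts the equal word `x` as well, so it is also a code of `x`.
  ; cong      = λ {x} {y} x≈y → IsCode-unique (proj₁ x) (code-is x)
                  (Sorts⇒IsCode (proj₁ x) (code y)
                    (Sorts-resp-≗ (proj₁ x) (proj₁ y) x≈y (code y) (code-sorts y)))
  -- Equal codes order the values alike, which fixes the word; for surjectivity, the values are
  -- sorted by the given code.
  ; bijective = (λ {x} {y} eq → ≗-from-order (proj₁ x) (proj₁ y)
                  (Sorts⁻¹ (proj₁ y) (code y) (code-sorts y)
                    ∘ ≺-resp-mark (code x) (code y) eq ∘ code-sorts x))
              , decode
  }
  where
  Avoider : Set
  Avoider = Setoid.Carrier (Avoiders 3-12-3 (suc n))

  code : Avoider → Code n
  code (π , _) = proj₁ (permCode π)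

  code-is : (x : Avoider) → IsCode (proj₁ x) (code x)
  code-is (π , _) = proj₂ (permCode π)

  code-sorts : (x : Avoider) → Sorts (proj₁ x) (code x)
  code-sorts x@(π , avoids) = IsCode∧Avoids⇒Sorts π (code x) (code-is x) avoids

  decode : ∀ κ → ∃ λ x → ∀ {z} → (proj₁ z ⟨$⟩ʳ_) ≗ (proj₁ x ⟨$⟩ʳ_) → mark (code z) ≗ mark κ
  decode κ = (sorted , Sorts⇒Avoids sorted κ sorted-reflects) , λ {z} z≈x →
    IsCode-unique (proj₁ z) (code-is z)
      (Sorts⇒IsCode (proj₁ z) κ (Sorts-resp-≗ (proj₁ z) sorted z≈x κ sorted-reflects))
    where open Sorting (Code.≺-irrefl κ) (λ {i} {j} {k} → Code.≺-trans κ {i} {j} {k}) (Code.≺-connex κ)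

-- Codes and bicoloured partitions

∈-⋃⁺ : {S : Subset n} {Ss : List (Subset n)} {i : Fin n} → S ∈ᴸ Ss → i ∈ S → i ∈ ⋃ Ss
∈-⋃⁺ (here refl) i∈S = x∈p∪q⁺ (inj₁ i∈S)
∈-⋃⁺ (there S∈)  i∈S = x∈p∪q⁺ (inj₂ (∈-⋃⁺ S∈ i∈S))

∈-⋃⁻ : (Ss : List (Subset n)) {i : Fin n} → i ∈ ⋃ Ss → ∃ λ S → S ∈ᴸ Ss × i ∈ S
∈-⋃⁻ []       i∈ = contradiction i∈ ∉⊥
∈-⋃⁻ (S ∷ Ss) i∈ with x∈p∪q⁻ S (⋃ Ss) i∈
... | inj₁ i∈S = S , here refl , i∈S
... | inj₂ i∈′ with T , T∈ , i∈T ← ∈-⋃⁻ Ss i∈′ = T , there T∈ , i∈T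

module _ {A : Set} (f : A → Subset n) where

  -- Entries at different places have disjoint images, so a shared element forces the same place.
  -- The entries themselves then agree, and for coloured blocks so do the colours.
  disjoint⇒unique : {xs : List A} → AllPairs (λ B C → Empty (B ∩ C)) (map f xs) →
                    ∀ {x y i} → x ∈ᴸ xs → y ∈ᴸ xs → i ∈ f x → i ∈ f y → x ≡ y
  disjoint⇒unique _          (here refl) (here refl) _   _   = refl
  disjoint⇒unique (d ∷ _)    (here refl) (there y∈)  i∈x i∈y =
    contradiction (_ , x∈p∩q⁺ (i∈x , i∈y)) (All.lookup d (∈-map⁺ f y∈))
  disjoint⇒unique (d ∷ _)    (there x∈)  (here refl) i∈x i∈y =
    contradiction (_ , x∈p∩q⁺ (i∈y , i∈x)) (All.lookup d (∈-map⁺ f x∈))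
  disjoint⇒unique (_ ∷ rest) (there x∈)  (there y∈)  i∈x i∈y =
    disjoint⇒unique rest x∈ y∈ i∈x i∈y

top-elim : (P : Fin (suc n) → Set) → P (fromℕ n) → (∀ i → P (inject₁ i)) → ∀ i → P i
top-elim P pt pi i with view i
... | ‵fromℕ     = pt
... | ‵inject₁ j = pi j

≢top⇒inject₁ : {i : Fin (suc n)} → i ≢ fromℕ n → ∃ λ j → i ≡ inject₁ j
≢top⇒inject₁ {i = i} i≢top with view i
... | ‵fromℕ     = contradiction refl i≢top
... | ‵inject₁ j = j , refl

module _ {A : Set} (a : A) (f : Fin n → A) where

  extend : Fin (suc n) → A
  extend i with view i
  ... | ‵fromℕ     = a
  ... | ‵inject₁ j = f j

  extend-top : extend (fromℕ n) ≡ a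
  extend-top rewrite view-fromℕ n = refl

  extend-inject₁ : ∀ i → extend (inject₁ i) ≡ f i
  extend-inject₁ i rewrite view-inject₁ i = refl

-- From codes to bicoloured partitions

module _ (κ : Code n) where
  open Code κ

  _∈Block?_ : ∀ i m → Dec (head (inject₁ i) ≡ inject₁ m)
  i ∈Block? m = head (inject₁ i) ≟ inject₁ m

  block : Fin n → Subset n
  block m = comprehension (_∈Block? m)

  ∈-block⁺ : ∀ {i m} → head (inject₁ i) ≡ inject₁ m → i ∈ block m
  ∈-block⁺ {m = m} = ∈-comprehension⁺ (_∈Block? m)

  ∈-block⁻ : ∀ {i m} → i ∈ block m → head (inject₁ i) ≡ inject₁ m
  ∈-block⁻ {m = m} = ∈-comprehension⁻ (_∈Block? m)

  IsHead : Pred (Fin n) 0ℓ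
  IsHead m = head (inject₁ m) ≡ inject₁ m

  isHead? : Decidable IsHead
  isHead? m = m ∈Block? m

  colouredBlock : Fin n → Subset n × Colour
  colouredBlock m = block m , colour (inject₁ m)

  -- Filtering by `isHead?` lists each block once, under its maximum; at any other index `block` is
  -- empty.
  codeBlocks : List (Subset n × Colour)
  codeBlocks = map colouredBlock (filter isHead? (allFin n))

  ∈-codeBlocks⁺ : ∀ {m} → IsHead m → colouredBlock m ∈ᴸ codeBlocks
  ∈-codeBlocks⁺ {m} m-head =
    ∈-map∘filter⁺ colouredBlock isHead? (m , ∈-allFin m , refl , m-head)

  ∈-codeBlocks⁻ : ∀ {x} → x ∈ᴸ codeBlocks → ∃ λ m → x ≡ colouredBlock m × IsHead m
  ∈-codeBlocks⁻ x∈ with m , _ , eq , m-head ← ∈-map∘filter⁻ colouredBlock isHead? {xs = allFin n} x∈ =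
    m , eq , m-head

  -- By `head-top⁻` the top heads only itself, so dropping it leaves the other blocks intact.
  headOf : ∀ i → ∃ λ m → head (inject₁ i) ≡ inject₁ m
  headOf i = ≢top⇒inject₁ (fromℕ≢inject₁ ∘ sym ∘ head-top⁻)

  headOf-isHead : ∀ {i m} → head (inject₁ i) ≡ inject₁ m → IsHead m
  headOf-isHead {i} eq = subst (λ h → head h ≡ h) eq (head-head (inject₁ i))

  blocksDisjoint : ∀ {l m} → l ≢ m → Empty (block l ∩ block m)
  blocksDisjoint {l} {m} l≢m (i , i∈) with i∈l , i∈m ← x∈p∩q⁻ (block l) (block m) i∈ =
    l≢m (inject₁-injective (trans (sym (∈-block⁻ i∈l)) (∈-block⁻ i∈m)))

  codePartition : BicolouredPartition n
  codePartition = record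
    { colouredBlocks = codeBlocks
    ; isSetPartition = record
      { nonempty = All.map⁺ (All.map⁺ (All.map (λ {m} m-head → m , ∈-block⁺ m-head)
                     (all-filter isHead? (allFin n))))
      ; disjoint = AllPairs.map⁺ (AllPairs.map⁺ (AllPairs.filter⁺ isHead?
                     (AllPairs.tabulate⁺ blocksDisjoint)))
      ; covering = ⊆-antisym ⊆⊤ λ {i} _ →
          let m , eq = headOf i in
          ∈-⋃⁺ (∈-map⁺ proj₁ (∈-codeBlocks⁺ (headOf-isHead eq))) (∈-block⁺ eq)
      }
    }

codeBlocks-resp-mark : (κ μ : Code n) → mark κ ≗ mark μ →
                       ∀ {x} → x ∈ᴸ codeBlocks κ → x ∈ᴸ codeBlocks μ
codeBlocks-resp-mark κ μ κ≗μ x∈ with m , refl , m-head ← ∈-codeBlocks⁻ κ x∈ =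
  subst (_∈ᴸ codeBlocks μ)
    (sym (cong₂ _,_ (tabulate-cong λ i → cong (λ h → does (h ≟ inject₁ m)) (head≡ (inject₁ i)))
                    (cong proj₁ (κ≗μ (inject₁ m)))))
    (∈-codeBlocks⁺ μ (trans (sym (head≡ (inject₁ m))) m-head))
  where
  head≡ : ∀ i → Code.head κ i ≡ Code.head μ i
  head≡ i = cong proj₂ (κ≗μ i)

inject₁-mono-≤ : {i j : Fin n} → i ≤ j → inject₁ i ≤ inject₁ j
inject₁-mono-≤ = subst₂ ℕ._≤_ (sym (toℕ-inject₁ _)) (sym (toℕ-inject₁ _))

-- The block of `i` in `κ` reappears in `μ` with its colour. Its head is recovered as its largest
-- element: `m` and `m′` lie in the same set, and each bounds it.
codeBlocks-⊆⇒≗ : (κ μ : Code n) → (∀ {x} → x ∈ᴸ codeBlocks κ → x ∈ᴸ codeBlocks μ) →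
                 mark κ ≗ mark μ
codeBlocks-⊆⇒≗ {n} κ μ κ⊆μ = top-elim (λ i → mark κ i ≡ mark μ i)
  (cong₂ _,_ (trans (Code.colour-top κ) (sym (Code.colour-top μ)))
             (trans (Code.head-top κ) (sym (Code.head-top μ))))
  mark≡
  where
  mark≡ : ∀ i → mark κ (inject₁ i) ≡ mark μ (inject₁ i)
  mark≡ i
    with m , hi≡m ← headOf κ i
    with m′ , block≡ , m′-head ← ∈-codeBlocks⁻ μ (κ⊆μ (∈-codeBlocks⁺ κ (headOf-isHead κ hi≡m))) =
    cong₂ _,_
      (trans (colour-of κ hi≡m) (trans (cong proj₂ block≡)
        (sym (colour-of μ (∈-block⁻ μ (κ⇒μ (∈-block⁺ κ hi≡m)))))))
      (trans hi≡m (trans (cong inject₁ m≡m′) (sym (∈-block⁻ μ (κ⇒μ (∈-block⁺ κ hi≡m))))))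
    where
    κ⇒μ : ∀ {j} → j ∈ block κ m → j ∈ block μ m′
    κ⇒μ = subst (_ ∈_) (cong proj₁ block≡)
    m≤m′ : inject₁ m ≤ inject₁ m′
    m≤m′ = subst (inject₁ m ≤_) (∈-block⁻ μ (κ⇒μ (∈-block⁺ κ (headOf-isHead κ hi≡m))))
                 (Code.≤head μ _)
    m′≤m : inject₁ m′ ≤ inject₁ m
    m′≤m = subst (inject₁ m′ ≤_)
      (∈-block⁻ κ (subst (m′ ∈_) (sym (cong proj₁ block≡)) (∈-block⁺ μ m′-head))) (Code.≤head κ _)
    m≡m′ : m ≡ m′
    m≡m′ = inject₁-injective (≤-antisym m≤m′ m′≤m)
    colour-of : ∀ (ν : Code n) {j l} → Code.head ν (inject₁ j) ≡ inject₁ l →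
                Code.colour ν (inject₁ j) ≡ Code.colour ν (inject₁ l)
    colour-of ν eq = trans (sym (Code.colour-head ν _)) (cong (Code.colour ν) eq)

-- From bicoloured partitions to codes

module _ (P : BicolouredPartition n) where
  open BicolouredPartition P
  open IsSetPartition isSetPartition

  blockOf : ∀ i → ∃ λ B → B ∈ᴸ colouredBlocks × i ∈ proj₁ B
  blockOf i
    with S , S∈ , i∈S ← ∈-⋃⁻ (map proj₁ colouredBlocks) (subst (i ∈_) (sym covering) ∈⊤)
    with B , B∈ , refl ← ∈-map⁻ proj₁ S∈ = B , B∈ , i∈S

  private
    B⟨_⟩ : Fin n → Subset n × Colour
    B⟨ i ⟩ = proj₁ (blockOf i)

    B∈ : ∀ i → B⟨ i ⟩ ∈ᴸ colouredBlocks
    B∈ i = proj₁ (proj₂ (blockOf i))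

    ∈B : ∀ i → i ∈ proj₁ B⟨ i ⟩
    ∈B i = proj₂ (proj₂ (blockOf i))

    B-unique : ∀ {C i} → C ∈ᴸ colouredBlocks → i ∈ proj₁ C → B⟨ i ⟩ ≡ C
    B-unique {i = i} C∈ i∈C = disjoint⇒unique proj₁ disjoint (B∈ i) C∈ (∈B i) i∈C

    largest : ∀ i → ∃ (IsMaximum (_∈ proj₁ B⟨ i ⟩))
    largest i = maximum (_∈? proj₁ B⟨ i ⟩) (i , ∈B i)

    leader : Fin n → Fin n
    leader i = proj₁ (largest i)

    leader∈ : ∀ i → leader i ∈ proj₁ B⟨ i ⟩
    leader∈ i = proj₁ (proj₂ (largest i))

    ≤leader : ∀ i → i ≤ leader i
    ≤leader i = proj₂ (proj₂ (largest i)) (∈B i)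

    B-leader : ∀ i → B⟨ leader i ⟩ ≡ B⟨ i ⟩
    B-leader i = B-unique (B∈ i) (leader∈ i)

    leader-cong : ∀ {i j} → B⟨ i ⟩ ≡ B⟨ j ⟩ → leader i ≡ leader j
    leader-cong {i} {j} eq = maximum-unique (proj₂ (largest i))
      (subst (λ B → IsMaximum (_∈ proj₁ B) (leader j)) (sym eq) (proj₂ (largest j)))

    -- The top, absent from the partition, becomes a left block of its own.
    colour′ : Fin (suc n) → Colour
    colour′ = extend left (λ i → proj₂ B⟨ i ⟩)

    head′ : Fin (suc n) → Fin (suc n)
    head′ = extend (fromℕ n) (inject₁ ∘ leader)

    colour-inject₁ : ∀ i → colour′ (inject₁ i) ≡ proj₂ B⟨ i ⟩
    colour-inject₁ = extend-inject₁ _ _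

    head-inject₁ : ∀ i → head′ (inject₁ i) ≡ inject₁ (leader i)
    head-inject₁ = extend-inject₁ _ _

    head-top′ : head′ (fromℕ n) ≡ fromℕ n
    head-top′ = extend-top (fromℕ n) (inject₁ ∘ leader)

  partitionCode : Code n
  partitionCode = record
    { colour      = colour′
    ; head        = head′
    ; ≤head       = top-elim (λ i → i ≤ head′ i) (≤-reflexive (sym head-top′))
                      (λ i → subst (inject₁ i ≤_) (sym (head-inject₁ i)) (inject₁-mono-≤ (≤leader i)))
    ; head-head   = top-elim (λ i → head′ (head′ i) ≡ head′ i) (cong head′ head-top′)
                      (λ i → trans (cong head′ (head-inject₁ i)) (trans (head-inject₁ (leader i))
                        (trans (cong inject₁ (leader-cong (B-leader i))) (sym (head-inject₁ i)))))
    ; colour-head = top-elim (λ i → colour′ (head′ i) ≡ colour′ i) (cong colour′ head-top′)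
                      (λ i → trans (cong colour′ (head-inject₁ i)) (trans (colour-inject₁ (leader i))
                        (trans (cong proj₂ (B-leader i)) (sym (colour-inject₁ i)))))
    ; colour-top  = extend-top left (λ i → proj₂ B⟨ i ⟩)
    ; head-top⁻   = λ {i} → top-elim (λ i → head′ i ≡ fromℕ n → i ≡ fromℕ n) (λ _ → refl)
                      (λ i eq → contradiction (trans (sym eq) (head-inject₁ i)) fromℕ≢inject₁) i
    }

  private
    -- A value shares its block with its leader, so having leader `m` and lying in the block of `m`
    -- are the same when `m` leads itself.
    colouredBlock≡ : ∀ {m} → leader m ≡ m → colouredBlock partitionCode m ≡ B⟨ m ⟩
    colouredBlock≡ {m} m-leader = cong₂ _,_ (⊆-antisym to from) (colour-inject₁ m)
      where
      to : ∀ {i} → i ∈ block partitionCode m → i ∈ proj₁ B⟨ m ⟩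
      to {i} i∈ = subst (λ B → i ∈ proj₁ B) (trans (sym (B-leader i)) (cong B⟨_⟩ leader≡m)) (∈B i)
        where
        leader≡m : leader i ≡ m
        leader≡m = inject₁-injective (trans (sym (head-inject₁ i)) (∈-block⁻ partitionCode i∈))
      from : ∀ {i} → i ∈ proj₁ B⟨ m ⟩ → i ∈ block partitionCode m
      from {i} i∈ = ∈-block⁺ partitionCode (trans (head-inject₁ i)
        (cong inject₁ (trans (leader-cong (B-unique (B∈ m) i∈)) m-leader)))

  ∈-partitionCode⁻ : ∀ {x} → x ∈ᴸ codeBlocks partitionCode → x ∈ᴸ colouredBlocks
  ∈-partitionCode⁻ x∈ with m , refl , m-head ← ∈-codeBlocks⁻ partitionCode x∈ =
    subst (_∈ᴸ colouredBlocks)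
      (sym (colouredBlock≡ (inject₁-injective (trans (sym (head-inject₁ m)) m-head)))) (B∈ m)

  -- Nonemptiness supplies an element `i` of the block, and the leader of `i` is the index under
  -- which the code lists that block.
  ∈-partitionCode⁺ : ∀ {x} → x ∈ᴸ colouredBlocks → x ∈ᴸ codeBlocks partitionCode
  ∈-partitionCode⁺ {x} x∈ with i , i∈x ← All.lookup nonempty (∈-map⁺ proj₁ x∈) =
    subst (_∈ᴸ codeBlocks partitionCode)
      (trans (colouredBlock≡ m-leader) (trans (B-leader i) (B-unique x∈ i∈x)))
      (∈-codeBlocks⁺ partitionCode (trans (head-inject₁ m) (cong inject₁ m-leader)))
    where
    m = leader i
    m-leader : leader m ≡ m
    m-leader = leader-cong (B-leader i)

codes⤖partitions : (n : ℕ) → Bijection (Codes n) (BicolouredPartitions n)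
codes⤖partitions n = record
  { to        = codePartition
  ; cong      = λ {κ} {μ} → codePartition-cong {κ} {μ}
  ; bijective = (λ {κ} {μ} eq → codeBlocks-⊆⇒≗ κ μ (Equivalence.to eq))
              , λ P → partitionCode P , λ {κ} κ≗ →
                  Setoid.trans (BicolouredPartitions n)
                    {codePartition κ} {codePartition (partitionCode P)} {P}
                    (codePartition-cong {κ} {partitionCode P} κ≗)
                    (mk⇔ (∈-partitionCode⁻ P) (∈-partitionCode⁺ P))
  }
  where
  codePartition-cong : ∀ {κ μ} → mark κ ≗ mark μ →
                       Setoid._≈_ (BicolouredPartitions n) (codePartition κ) (codePartition μ)
  codePartition-cong {κ} {μ} κ≗μ =
    mk⇔ (codeBlocks-resp-mark κ μ κ≗μ) (codeBlocks-resp-mark μ κ (sym ∘ κ≗μ))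

corollary3 : (n : ℕ) → Bijection (Avoiders 3-12-3 (suc n)) (BicolouredPartitions n)
corollary3 n = bijection (avoiders⤖codes n) (codes⤖partitions n)
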